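{- Let $t,n,m$ be positive integers with $m=t(n-t)$. Then the complete bipartite graph $K_{t,n-t}$ is the unique (up to isomorphism) bipartite optimal graph in $\mathfrak{B}_{n,m}$.
   Context: All graphs are finite, simple and undirected. For a graph $G$ on $n$ vertices with adjacency matrix $\mathbf{A}(G)$, write $\det(\lambda I-\mathbf{A}(G))=\sum_{i=0}^n \mathbf{a}_i(G)\lambda^{n-i}$, so $\mathbf{a}_4(G)$ is the coefficient of $\lambda^{n-4}$. $\mathfrak{B}_{n,m}$ is the set of connected bipartite graphs with $n$ vertices and $m$ edges; $G\in\mathfrak{B}_{n,m}$ is bipartite optimal if $\mathbf{a}_4(G)=\min\{\mathbf{a}_4(H):H\in\mathfrak{B}_{n,m}\}$. -}

module Defs where

open import Data.Bool using (Bool; true; false; if_then_else_; _xor_)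
open import Data.Nat as ℕ using (ℕ; zero; suc; _∸_; _<ᵇ_)
open import Data.Integer as ℤ using (ℤ; +_; -_)
open import Data.Fin using (Fin; zero; suc; toℕ; punchIn; _≟_)
open import Relation.Nullary using (yes; no)
open import Data.List using (List; []; _∷_)
open import Data.Product using (Σ; _×_; ∃)
open import Relation.Binary.PropositionalEquality using (_≡_; _≢_)
open import Function.Bundles using (_↔_; Inverse)

Graph : ℕ → Set
Graph n = Fin n → Fin n → Bool

IsSimple : ∀ {n} → Graph n → Set
IsSimple {n} G = (∀ i j → G i j ≡ G j i) × (∀ i → G i i ≡ false)

data Reach {n} (G : Graph n) : Fin n → Fin n → Set where
  here : ∀ {i} → Reach G i i
  step : ∀ {i j k} → G i k ≡ true → Reach G k j → Reach G i j

Connected : ∀ {n} → Graph n → Set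
Connected {n} G = ∀ (i j : Fin n) → Reach G i j

Bipartite : ∀ {n} → Graph n → Set
Bipartite {n} G = Σ (Fin n → Bool) λ c → ∀ i j → G i j ≡ true → c i ≢ c j

sumFin : ∀ {n} → (Fin n → ℕ) → ℕ
sumFin {zero}  f = 0
sumFin {suc n} f = f zero ℕ.+ sumFin (λ i → f (suc i))

numEdges : ∀ {n} → Graph n → ℕ
numEdges G = sumFin λ i → sumFin λ j →
  if toℕ i <ᵇ toℕ j then (if G i j then 1 else 0) else 0

InB : (n m : ℕ) → Graph n → Set
InB n m G = IsSimple G × Connected G × Bipartite G × (numEdges G ≡ m)

-- Integer polynomials as coefficient lists (lowest degree first).

Poly : Set
Poly = List ℤ

_+P_ : Poly → Poly → Poly
[] +P q = q
(a ∷ p) +P [] = a ∷ p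
(a ∷ p) +P (b ∷ q) = (a ℤ.+ b) ∷ (p +P q)

scaleP : ℤ → Poly → Poly
scaleP c [] = []
scaleP c (a ∷ p) = (c ℤ.* a) ∷ scaleP c p

_*P_ : Poly → Poly → Poly
[] *P q = []
(a ∷ p) *P q = scaleP a q +P (+ 0 ∷ (p *P q))

negP : Poly → Poly
negP = scaleP (- (+ 1))

coeff : Poly → ℕ → ℤ
coeff [] k = + 0
coeff (a ∷ p) zero = a
coeff (a ∷ p) (suc k) = coeff p k

det : ∀ {n} → (Fin n → Fin n → Poly) → Poly
det {zero}  M = + 1 ∷ []
det {suc n} M = go (suc n) (λ j → j) true
  where
  go : (k : ℕ) → (Fin k → Fin (suc n)) → Bool → Poly
  go zero    col s = []
  go (suc k) col s =
    (let j = col zero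
         t = M zero j *P det (λ i l → M (suc i) (punchIn j l))
     in if s then t else negP t)
    +P go k (λ i → col (suc i)) (if s then false else true)

adj : ∀ {n} → Graph n → Fin n → Fin n → ℤ
adj G i j = if G i j then + 1 else + 0

charPoly : ∀ {n} → Graph n → Poly
charPoly {n} G = det M
  where
  M : Fin n → Fin n → Poly
  M i j with i ≟ j
  ... | yes _ = (- adj G i j) ∷ + 1 ∷ []
  ... | no  _ = (- adj G i j) ∷ []

acoef : ∀ {n} → ℕ → Graph n → ℤ
acoef {n} k G = if n ℕ.<ᵇ k then + 0 else coeff (charPoly G) (n ∸ k)

a4 : ∀ {n} → Graph n → ℤ
a4 = acoef 4

BipOptimal : (n m : ℕ) → Graph n → Set
BipOptimal n m G = InB n m G × (∀ (H : Graph n) → InB n m H → a4 G ℤ.≤ a4 H)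

K : (n t : ℕ) → Graph n
K n t i j = (toℕ i <ᵇ t) xor (toℕ j <ᵇ t)

_≅_ : ∀ {n} → Graph n → Graph n → Set
_≅_ {n} G H = Σ (Fin n ↔ Fin n) λ σ →
  ∀ i j → H (Inverse.to σ i) (Inverse.to σ j) ≡ G i j

{-# OPTIONS --safe #-}
module Submission where

-- The coefficient a₄ is the sum of the principal 4 × 4 minors of the adjacency
-- matrix. On a bipartite graph each of them is nonnegative, and it is positive
-- on an induced path with four vertices. Complete bipartite graphs have rank two,
-- so their a₄ vanishes and is the minimum. A minimiser therefore has no induced
-- path on four vertices, and being connected it is complete bipartite; its part
-- sizes have sum n and product t (n − t), hence are t and n − t.

open import Defs
open import Data.Bool using (Bool; true; false; if_then_else_; _xor_; _∧_; not)
import Data.Bool as Bool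
open import Data.Bool.Properties using (T-≡; xor-same; xor-comm; xor-annihilates-not; not-injective; not-¬; ¬-not)
open import Data.Empty using (⊥)
open import Data.Nat as ℕ using (ℕ; zero; suc; _≤_; _*_; _∸_; _<ᵇ_; z≤n; s≤s)
import Data.Nat.Properties as ℕ
open import Data.Integer as ℤ using (ℤ; +_; -_; 0ℤ; 1ℤ)
import Data.Integer.Properties as ℤ
open import Data.Integer.Tactic.RingSolver using (solve-∀)
open import Data.Fin using (Fin; zero; suc; toℕ; punchIn; punchOut; pinch; fromℕ<; _≟_; #_)
import Data.Fin as Fin
open import Data.Fin.Properties as Fin using (punchIn-punchOut; toℕ<n; toℕ-fromℕ<; toℕ-injective)
open import Data.Fin.Permutation as Permutation using (Permutation′; _⟨$⟩ʳ_; insert)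
open import Data.Vec.Functional using (insertAt; removeAt)
open import Data.Vec.Functional.Properties using (insertAt-lookup; insertAt-punchIn)
open import Data.Vec using ([]; _∷_; lookup; tabulate)
open import Data.Vec.Properties using (lookup∘tabulate)
open import Data.List using ([]; _∷_)
open import Data.Product using (_×_; _,_; proj₁; proj₂; Σ; ∃)
open import Data.Sum using (_⊎_; inj₁; inj₂)
open import Function using (_∘_)
open import Function.Bundles using (Equivalence)
open import Relation.Nullary using (Dec; yes; no; ¬_; contradiction)
open import Relation.Nullary.Decidable using (toWitness; map′; _×-dec_; _⊎-dec_; ¬?)
open import Relation.Binary.PropositionalEquality

-- The expansion into principal minors is never written as an indexed sum. Nonnegativity and
-- vanishing are stable under addition, and positivity survives adding nonnegative terms, so it
-- suffices to split a determinant in two at one row: either the λ of that row is dropped, or row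
-- and column are deleted. This forces matrices in which only some rows carry λ, and classes of
-- graphs closed under deleting vertices. On four vertices the determinant is M - 2C, with M perfect
-- matchings and C four-cycles. A four-cycle is a pair of perfect matchings, so the value is 0, 1,
-- 0, -3 for M = 0, 1, 2, 3. It is negative only for the complete graph, and positive exactly when
-- there is a single perfect matching.

private
  variable
    n : ℕ

-- The local function of det is not in scope here; unification recovers it from
-- the part of the expansion after the first two columns, whose size argument
-- can be told apart from its column counter.
mutual
  rest : ∀ n → (Fin (suc (suc n)) → Fin (suc (suc n)) → Poly) → Poly
  rest = _

  det-rest : ∀ n (M : Fin (suc (suc n)) → Fin (suc (suc n)) → Poly) →
    det M ≡ (M zero zero *P det (λ i j → M (suc i) (suc j)))
            +P (negP (M zero (suc zero) *P det (λ i j → M (suc i) (punchIn (suc zero) j)))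
                +P rest n M)
  det-rest n M = refl

mutual
  expand : ∀ n → (Fin (suc n) → Fin (suc n) → Poly) →
    (k : ℕ) → (Fin k → Fin (suc n)) → Bool → Poly
  expand = _

  rest-expand : ∀ n (M : Fin (suc (suc n)) → Fin (suc (suc n)) → Poly) →
    rest n M ≡ expand (suc n) M n (λ i → suc (suc i)) true
  -- Abstracting the arguments leaves `expand` applied to distinct variables, a pattern with a
  -- unique solution.
  rest-expand n M with suc n | (λ (i : Fin n) → Fin.suc (Fin.suc i)) | true
  ... | _ | _ | _ = refl

mutual
  charMatrix : Graph n → Fin n → Fin n → Poly
  charMatrix = _

  charPoly-det : (G : Graph n) → charPoly G ≡ det (charMatrix G)
  charPoly-det G = refl

-- Coefficient sequences and alternating sums

coeff-+P : ∀ p q k → coeff (p +P q) k ≡ coeff p k ℤ.+ coeff q k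
coeff-+P []      q       k       = sym (ℤ.+-identityˡ _)
coeff-+P (a ∷ p) []      k       = sym (ℤ.+-identityʳ _)
coeff-+P (a ∷ p) (b ∷ q) zero    = refl
coeff-+P (a ∷ p) (b ∷ q) (suc k) = coeff-+P p q k

coeff-scaleP : ∀ c p k → coeff (scaleP c p) k ≡ c ℤ.* coeff p k
coeff-scaleP c []      k       = sym (ℤ.*-zeroʳ c)
coeff-scaleP c (a ∷ p) zero    = refl
coeff-scaleP c (a ∷ p) (suc k) = coeff-scaleP c p k

-- Matrices whose entries (a , b) stand for the linear polynomials a + b λ.
Mat : ℕ → Set
Mat n = Fin n → Fin n → ℤ × ℤ

shift : (ℕ → ℤ) → ℕ → ℤ
shift f zero    = 0ℤ
shift f (suc k) = f k

-- Multiplication by `a + b λ` on coefficient sequences; sequences avoid the trailing zeros that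
-- distinguish equal polynomials as lists.
act : ℤ × ℤ → (ℕ → ℤ) → ℕ → ℤ
act (a , b) f k = a ℤ.* f k ℤ.+ b ℤ.* shift f k

altSum : (Fin n → ℤ) → ℤ
altSum {zero}  f = 0ℤ
altSum {suc n} f = f zero ℤ.- altSum (f ∘ suc)

minor : Fin (suc n) → Fin (suc n) → Mat (suc n) → Mat n
minor i j X k l = X (punchIn i k) (punchIn j l)

detCoeff : Mat n → ℕ → ℤ
detCoeff {zero}  X zero    = 1ℤ
detCoeff {zero}  X (suc k) = 0ℤ
detCoeff {suc n} X k = altSum λ j → act (X zero j) (detCoeff (minor zero j X)) k

rowTerm : Mat (suc n) → ℕ → Fin (suc n) → ℤ
rowTerm X k j = act (X zero j) (detCoeff (minor zero j X)) k

altSum-cong : {f g : Fin n → ℤ} → (∀ i → f i ≡ g i) → altSum f ≡ altSum g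
altSum-cong {zero}  e = refl
altSum-cong {suc n} e = cong₂ ℤ._-_ (e zero) (altSum-cong (e ∘ suc))

altSum-zero : {f : Fin n → ℤ} → (∀ i → f i ≡ 0ℤ) → altSum f ≡ 0ℤ
altSum-zero {zero}  e = refl
altSum-zero {suc n} e = cong₂ ℤ._-_ (e zero) (altSum-zero (e ∘ suc))

altSum-+ : ∀ {f : Fin n → ℤ} g h → (∀ i → f i ≡ g i ℤ.+ h i) →
  altSum f ≡ altSum g ℤ.+ altSum h
altSum-+ {zero}  g h e = refl
altSum-+ {suc n} g h e
  rewrite e zero | altSum-+ (g ∘ suc) (h ∘ suc) (e ∘ suc) =
  lem (g zero) (h zero) (altSum (g ∘ suc)) (altSum (h ∘ suc))
  where
  lem : ∀ a b c d → (a ℤ.+ b) ℤ.- (c ℤ.+ d) ≡ (a ℤ.- c) ℤ.+ (b ℤ.- d)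
  lem = solve-∀

altSum-neg : (f : Fin n → ℤ) → altSum (λ i → - f i) ≡ - altSum f
altSum-neg {zero}  f = refl
altSum-neg {suc n} f rewrite altSum-neg (f ∘ suc) =
  sym (ℤ.neg-distrib-+ (f zero) (- altSum (f ∘ suc)))

shift-cong : {f g : ℕ → ℤ} → (∀ k → f k ≡ g k) → ∀ k → shift f k ≡ shift g k
shift-cong e zero    = refl
shift-cong e (suc k) = e k

act-cong : ∀ x {f g} → (∀ k → f k ≡ g k) → ∀ k → act x f k ≡ act x g k
act-cong (a , b) e k =
  cong₂ (λ u v → a ℤ.* u ℤ.+ b ℤ.* v) (e k) (shift-cong e k)

act-zeroʳ : ∀ x f → (∀ k → f k ≡ 0ℤ) → ∀ k → act x f k ≡ 0ℤ
act-zeroʳ (a , b) f e k = cong₂ ℤ._+_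
  (trans (cong (a ℤ.*_) (e k)) (ℤ.*-zeroʳ a))
  (trans (cong (b ℤ.*_) (shifted k)) (ℤ.*-zeroʳ b))
  where
  shifted : ∀ k → shift f k ≡ 0ℤ
  shifted zero    = refl
  shifted (suc k) = e k

detCoeff-cong : {X Y : Mat n} → (∀ i j → X i j ≡ Y i j) →
  ∀ k → detCoeff X k ≡ detCoeff Y k
detCoeff-cong {zero}  e zero    = refl
detCoeff-cong {zero}  e (suc k) = refl
detCoeff-cong {suc n} {X} e k = altSum-cong λ j →
  trans (act-cong (X zero j) (detCoeff-cong (λ i l → e (suc i) (punchIn j l))) k)
    (cong (λ x → act x _ k) (e zero j))

-- Coefficients of determinants of linear polynomials.

-- Entries are compared through their action as left factors, which is how they occur in the
-- expansion of `det`.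
Represents : Poly → ℤ × ℤ → Set
Represents p x = ∀ q k → coeff (p *P q) k ≡ act x (coeff q) k

coeff-shift : ∀ q k → coeff (0ℤ ∷ q) k ≡ shift (coeff q) k
coeff-shift q zero    = refl
coeff-shift q (suc k) = refl

represents-const : ∀ a → Represents (a ∷ []) (a , 0ℤ)
represents-const a q k
  rewrite coeff-+P (scaleP a q) (0ℤ ∷ []) k | coeff-scaleP a q k | coeff-shift [] k
  with k
... | zero  = refl
... | suc _ = refl

represents-linear : ∀ a b → Represents (a ∷ b ∷ []) (a , b)
represents-linear a b q k
  rewrite coeff-+P (scaleP a q) (0ℤ ∷ ((b ∷ []) *P q)) k | coeff-scaleP a q k
  = cong (λ x → a ℤ.* coeff q k ℤ.+ x) (tail k)
  where
  tail : ∀ k → coeff (0ℤ ∷ ((b ∷ []) *P q)) k ≡ b ℤ.* shift (coeff q) k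
  tail zero    = sym (ℤ.*-zeroʳ b)
  tail (suc k) = trans (represents-const b q k) (ℤ.+-identityʳ _)

signed : Bool → ℤ → ℤ
signed s x = if s then x else - x

mutual
  coeff-det : ∀ (M : Fin n → Fin n → Poly) (X : Mat n) →
    (∀ i j → Represents (M i j) (X i j)) → ∀ k → coeff (det M) k ≡ detCoeff X k
  coeff-det {zero}  M X r zero    = refl
  coeff-det {zero}  M X r (suc k) = refl
  coeff-det {suc n} M X r k = coeff-expand M X r (suc n) (λ j → j) true k

  coeff-expand : ∀ (M : Fin (suc n) → Fin (suc n) → Poly) (X : Mat (suc n)) →
    (∀ i j → Represents (M i j) (X i j)) → ∀ c (col : Fin c → Fin (suc n)) s k →
    coeff (expand n M c col s) k
      ≡ signed s (altSum λ j → act (X zero (col j)) (detCoeff (minor zero (col j) X)) k)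
  coeff-expand M X r zero col true  k = refl
  coeff-expand M X r zero col false k = refl
  coeff-expand {n} M X r (suc c) col s k =
    trans (coeff-+P (head s) _ k)
      (trans (cong₂ ℤ._+_ (coeff-head s) (coeff-expand M X r c (col ∘ suc) (if s then false else true) k))
        (combine s _ _))
    where
    j = col zero
    t = M zero j *P det (λ i l → M (suc i) (punchIn j l))
    head : Bool → Poly
    head s = if s then t else negP t
    T = act (X zero j) (detCoeff (minor zero j X)) k
    coeff-t : coeff t k ≡ T
    coeff-t = trans (r zero j _ k)
      (act-cong (X zero j) (coeff-det _ (minor zero j X) (λ i l → r (suc i) (punchIn j l))) k)
    coeff-head : ∀ s → coeff (head s) k ≡ signed s T
    coeff-head true  = coeff-t
    coeff-head false = trans (coeff-scaleP (- (+ 1)) t k)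
      (trans (ℤ.-1*i≡-i _) (cong -_ coeff-t))
    combine : ∀ s x y → signed s x ℤ.+ signed (if s then false else true) y ≡ signed s (x ℤ.- y)
    combine true  x y = refl
    combine false x y = lem x y
      where
      lem : ∀ x y → - x ℤ.+ y ≡ - (x ℤ.- y)
      lem = solve-∀

-- Laplace expansion along an arbitrary row.

_⊕_ : ℤ × ℤ → ℤ × ℤ → ℤ × ℤ
(a , b) ⊕ (c , d) = a ℤ.+ c , b ℤ.+ d

act-⊕ : ∀ x y f k → act (x ⊕ y) f k ≡ act x f k ℤ.+ act y f k
act-⊕ (a , b) (c , d) f k = lem a b c d (f k) (shift f k)
  where
  lem : ∀ a b c d u v →
    (a ℤ.+ c) ℤ.* u ℤ.+ (b ℤ.+ d) ℤ.* v ≡ (a ℤ.* u ℤ.+ b ℤ.* v) ℤ.+ (c ℤ.* u ℤ.+ d ℤ.* v)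
  lem = solve-∀

shift-+ : {f g h : ℕ → ℤ} → (∀ k → f k ≡ g k ℤ.+ h k) →
  ∀ k → shift f k ≡ shift g k ℤ.+ shift h k
shift-+ e zero    = refl
shift-+ e (suc k) = e k

act-+ : ∀ x {f g h : ℕ → ℤ} → (∀ k → f k ≡ g k ℤ.+ h k) →
  ∀ k → act x f k ≡ act x g k ℤ.+ act x h k
act-+ (a , b) {f} {g} {h} e k rewrite e k | shift-+ e k =
  lem a b (g k) (h k) (shift g k) (shift h k)
  where
  lem : ∀ a b u v u' v' → a ℤ.* (u ℤ.+ v) ℤ.+ b ℤ.* (u' ℤ.+ v')
    ≡ (a ℤ.* u ℤ.+ b ℤ.* u') ℤ.+ (a ℤ.* v ℤ.+ b ℤ.* v')
  lem = solve-∀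

act-scale : ∀ x s f {g : ℕ → ℤ} → (∀ k → g k ≡ s ℤ.* f k) →
  ∀ k → act x g k ≡ s ℤ.* act x f k
act-scale (a , b) s f {g} e k = trans (cong₂ (λ u v → a ℤ.* u ℤ.+ b ℤ.* v) (e k) (shifted k))
  (lem a b s (f k) (shift f k))
  where
  shifted : ∀ k → shift g k ≡ s ℤ.* shift f k
  shifted zero    = sym (ℤ.*-zeroʳ s)
  shifted (suc k) = e k
  lem : ∀ a b s u v → a ℤ.* (s ℤ.* u) ℤ.+ b ℤ.* (s ℤ.* v) ≡ s ℤ.* (a ℤ.* u ℤ.+ b ℤ.* v)
  lem = solve-∀

altSum-scale : ∀ s (f : Fin n → ℤ) → altSum (λ i → s ℤ.* f i) ≡ s ℤ.* altSum f
altSum-scale {zero}  s f = sym (ℤ.*-zeroʳ s)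
altSum-scale {suc n} s f rewrite altSum-scale s (f ∘ suc) = lem s (f zero) (altSum (f ∘ suc))
  where
  lem : ∀ s u v → s ℤ.* u ℤ.- s ℤ.* v ≡ s ℤ.* (u ℤ.- v)
  lem = solve-∀

detCoeff-zero-row : ∀ p (X : Mat n) → (∀ j → X p j ≡ (0ℤ , 0ℤ)) → ∀ k → detCoeff X k ≡ 0ℤ
detCoeff-zero-row zero    X e k = altSum-zero λ j → cong (λ x → act x (detCoeff (minor zero j X)) k) (e j)
detCoeff-zero-row (suc p) X e k = altSum-zero λ j →
  act-zeroʳ (X zero j) _ (detCoeff-zero-row p (minor zero j X) λ l → e (punchIn j l)) k

detCoeff-row-+ : ∀ p (X Y Z : Mat (suc n)) →
  (∀ j → X p j ≡ Y p j ⊕ Z p j) →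
  (∀ i j → X (punchIn p i) j ≡ Y (punchIn p i) j) →
  (∀ i j → X (punchIn p i) j ≡ Z (punchIn p i) j) →
  ∀ k → detCoeff X k ≡ detCoeff Y k ℤ.+ detCoeff Z k
detCoeff-row-+ zero X Y Z e y z k = altSum-+ (rowTerm Y k) (rowTerm Z k) λ j →
  trans (cong (λ x → act x (detCoeff (minor zero j X)) k) (e j))
    (trans (act-⊕ (Y zero j) (Z zero j) _ k)
      (cong₂ ℤ._+_
        (act-cong (Y zero j) (detCoeff-cong λ i l → y i (punchIn j l)) k)
        (act-cong (Z zero j) (detCoeff-cong λ i l → z i (punchIn j l)) k)))
detCoeff-row-+ {suc n} (suc p) X Y Z e y z k = altSum-+ (rowTerm Y k) (rowTerm Z k) λ j →
  trans
    (act-+ (X zero j)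
      (detCoeff-row-+ p (minor zero j X) (minor zero j Y) (minor zero j Z)
        (λ l → e (punchIn j l))
        (λ i l → y (suc i) (punchIn j l))
        (λ i l → z (suc i) (punchIn j l))) k)
    (cong₂ (λ u v → act u (detCoeff (minor zero j Y)) k ℤ.+ act v (detCoeff (minor zero j Z)) k)
      (y zero j) (z zero j))

sign : Fin n → ℤ
sign zero    = 1ℤ
sign (suc i) = - sign i

sign-square : (i : Fin n) → sign i ℤ.* sign i ≡ 1ℤ
sign-square zero    = refl
sign-square (suc i) = trans (lem (sign i)) (sign-square i)
  where
  lem : ∀ x → - x ℤ.* - x ≡ x ℤ.* x
  lem = solve-∀

δ : Fin n → Fin n → ℤ
δ zero    zero    = 1ℤ
δ zero    (suc j) = 0ℤ
δ (suc i) zero    = 0ℤ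
δ (suc i) (suc j) = δ i j

δ-refl : (i : Fin n) → δ i i ≡ 1ℤ
δ-refl zero    = refl
δ-refl (suc i) = δ-refl i

δ-punchIn : ∀ (i : Fin (suc n)) j → δ i (punchIn i j) ≡ 0ℤ
δ-punchIn zero    j       = refl
δ-punchIn (suc i) zero    = refl
δ-punchIn (suc i) (suc j) = δ-punchIn i j

δ-punchIn² : ∀ (p : Fin (suc n)) i j → δ (punchIn p i) (punchIn p j) ≡ δ i j
δ-punchIn² zero    i       j       = refl
δ-punchIn² (suc p) zero    zero    = refl
δ-punchIn² (suc p) zero    (suc j) = refl
δ-punchIn² (suc p) (suc i) zero    = refl
δ-punchIn² (suc p) (suc i) (suc j) = δ-punchIn² p i j

-- Deleting c and then l amounts to deleting punchIn c l and then pinch l c.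
δ-pinch : ∀ (c : Fin (suc (suc n))) l j →
  δ c (punchIn (punchIn c l) j) ≡ δ (pinch l c) j
δ-pinch         zero    l       zero    = refl
δ-pinch         zero    l       (suc j) = refl
δ-pinch         (suc c) zero    j       = refl
δ-pinch         (suc c) (suc l) zero    = refl
δ-pinch {suc n} (suc c) (suc l) (suc j) = δ-pinch c l j

punchIn-pinch : ∀ (c : Fin (suc (suc n))) l j →
  punchIn (punchIn c l) (punchIn (pinch l c) j) ≡ punchIn c (punchIn l j)
punchIn-pinch zero    l       j       = refl
punchIn-pinch (suc c) zero    j       = refl
punchIn-pinch (suc c) (suc l) zero    = refl
punchIn-pinch (suc c) (suc l) (suc j) = cong suc (punchIn-pinch c l j)

altSum-single : ∀ (c : Fin (suc n)) (f : Fin (suc n) → ℤ) →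
  (∀ l → f (punchIn c l) ≡ 0ℤ) → altSum f ≡ sign c ℤ.* f c
altSum-single zero f e rewrite altSum-zero e = lem (f zero)
  where
  lem : ∀ x → x ℤ.- 0ℤ ≡ 1ℤ ℤ.* x
  lem = solve-∀
altSum-single {suc n} (suc c) f e
  rewrite e zero | altSum-single c (f ∘ suc) (λ l → e (suc l)) = lem (sign c) (f (suc c))
  where
  lem : ∀ s x → 0ℤ ℤ.- s ℤ.* x ≡ - s ℤ.* x
  lem = solve-∀

-*-swap : ∀ s x → - s ℤ.* x ≡ s ℤ.* - x
-*-swap = solve-∀

-- For `l` below `c`, column `l` keeps its place and `pinch l c` is `c − 1`; otherwise the column
-- moves up by one and `pinch l c` is `c`. In both cases the signs multiply to minus `sign c` times
-- the sign of `l`.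
altSum-punchIn : ∀ (c : Fin (suc (suc n))) (f : Fin (suc (suc n)) → ℤ) (g : Fin (suc n) → ℤ) →
  f c ≡ 0ℤ → (∀ l → f (punchIn c l) ≡ sign (pinch l c) ℤ.* g l) →
  altSum f ≡ - sign c ℤ.* altSum g
altSum-punchIn zero f g z e
  rewrite z | altSum-cong (λ l → trans (e l) (ℤ.*-identityˡ (g l))) = lem (altSum g)
  where
  lem : ∀ x → 0ℤ ℤ.- x ≡ - 1ℤ ℤ.* x
  lem = solve-∀
altSum-punchIn {zero} (suc zero) f g z e rewrite z | e zero = lem (g zero)
  where
  lem : ∀ x → 1ℤ ℤ.* x ℤ.- 0ℤ ≡ - (- 1ℤ) ℤ.* (x ℤ.- 0ℤ)
  lem = solve-∀
altSum-punchIn {suc n} (suc c) f g z e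
  rewrite e zero
  | altSum-punchIn c (f ∘ suc) (λ l → - g (suc l)) z
      (λ l → trans (e (suc l)) (-*-swap (sign (pinch l c)) (g (suc l))))
  | altSum-neg (g ∘ suc) = lem (sign c) (g zero) (altSum (g ∘ suc))
  where
  lem : ∀ s x y → s ℤ.* x ℤ.- (- s ℤ.* - y) ≡ - (- s) ℤ.* (x ℤ.- y)
  lem = solve-∀

shift-altSum-act : ∀ (x : Fin n → ℤ × ℤ) (f : Fin n → ℕ → ℤ) k →
  altSum (λ l → act (x l) (shift (f l)) k) ≡ shift (λ k → altSum λ l → act (x l) (f l) k) k
shift-altSum-act x f zero    = altSum-zero λ l → act-zeroʳ (x l) (λ _ → 0ℤ) (λ _ → refl) 0
shift-altSum-act x f (suc k) = refl

-- Row `p` is λ times a unit vector. Since `detCoeff` expands along row zero only, the induction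
-- passes to minors in which the row is again of this kind, with its entry in column `pinch l c`.
detCoeff-unit-row : ∀ p c (X : Mat (suc n)) → (∀ j → X p j ≡ (0ℤ , δ c j)) →
  ∀ k → detCoeff X k ≡ sign p ℤ.* sign c ℤ.* shift (detCoeff (minor p c X)) k
detCoeff-unit-row zero c X e k = begin
  altSum f             ≡⟨ altSum-single c f off ⟩
  sign c ℤ.* f c       ≡⟨ cong (λ x → sign c ℤ.* act x (detCoeff (minor zero c X)) k) (e c) ⟩
  sign c ℤ.* act (0ℤ , δ c c) (detCoeff (minor zero c X)) k
                       ≡⟨ cong (λ d → sign c ℤ.* act (0ℤ , d) (detCoeff (minor zero c X)) k) (δ-refl c) ⟩
  sign c ℤ.* act (0ℤ , 1ℤ) (detCoeff (minor zero c X)) k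
                       ≡⟨ lem (sign c) (detCoeff (minor zero c X) k) (shift (detCoeff (minor zero c X)) k) ⟩
  1ℤ ℤ.* sign c ℤ.* shift (detCoeff (minor zero c X)) k ∎
  where
  open ≡-Reasoning
  f = rowTerm X k
  off : ∀ l → f (punchIn c l) ≡ 0ℤ
  off l rewrite e (punchIn c l) | δ-punchIn c l = refl
  lem : ∀ s u v → s ℤ.* (0ℤ ℤ.* u ℤ.+ 1ℤ ℤ.* v) ≡ 1ℤ ℤ.* s ℤ.* v
  lem = solve-∀
detCoeff-unit-row {suc n} (suc p) c X e k = begin
  altSum f                            ≡⟨ altSum-punchIn c f g at-c off-c ⟩
  - sign c ℤ.* altSum g               ≡⟨ cong (- sign c ℤ.*_) (altSum-scale (sign p) h) ⟩
  - sign c ℤ.* (sign p ℤ.* altSum h)  ≡⟨ cong (λ x → - sign c ℤ.* (sign p ℤ.* x))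
                                          (shift-altSum-act (λ l → X zero (punchIn c l)) F k) ⟩
  - sign c ℤ.* (sign p ℤ.* shift (detCoeff (minor (suc p) c X)) k)
                                      ≡⟨ lem (sign c) (sign p) _ ⟩
  - sign p ℤ.* sign c ℤ.* shift (detCoeff (minor (suc p) c X)) k ∎
  where
  open ≡-Reasoning
  F = λ l → detCoeff (minor zero l (minor (suc p) c X))
  f = rowTerm X k
  h = λ l → act (X zero (punchIn c l)) (shift (F l)) k
  g = λ l → sign p ℤ.* h l
  at-c : f c ≡ 0ℤ
  -- Deleting column `c` removes the only nonzero entry of the unit row.
  at-c = act-zeroʳ (X zero c) _
    (detCoeff-zero-row p (minor zero c X) λ l →
      trans (e (punchIn c l)) (cong (0ℤ ,_) (δ-punchIn c l))) k
  off-c : ∀ l → f (punchIn c l) ≡ sign (pinch l c) ℤ.* g l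
  off-c l = trans
    (act-scale (X zero (punchIn c l)) (sign p ℤ.* sign (pinch l c)) (shift (F l)) inner k)
    (swap (sign p) (sign (pinch l c)) (h l))
    where
    swap : ∀ s t x → s ℤ.* t ℤ.* x ≡ t ℤ.* (s ℤ.* x)
    swap = solve-∀
    inner : ∀ k → detCoeff (minor zero (punchIn c l) X) k
      ≡ sign p ℤ.* sign (pinch l c) ℤ.* shift (F l) k
    inner k = trans
      (detCoeff-unit-row p (pinch l c) (minor zero (punchIn c l) X)
        (λ j → trans (e _) (cong (0ℤ ,_) (δ-pinch c l j))) k)
      (cong (sign p ℤ.* sign (pinch l c) ℤ.*_)
        (shift-cong (detCoeff-cong λ i j →
          cong (X (suc (punchIn p i))) (punchIn-pinch c l j)) k))
  lem : ∀ s t x → - s ℤ.* (t ℤ.* x) ≡ - t ℤ.* s ℤ.* x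
  lem = solve-∀

-- Additivity in row `p`: the second summand has only λ on the diagonal in that row, which leaves λ
-- times the principal minor, as the sign of a diagonal position is a square.
detCoeff-split : ∀ p (X Y : Mat (suc n)) →
  (∀ j → X p j ≡ Y p j ⊕ (0ℤ , δ p j)) →
  (∀ i j → X (punchIn p i) j ≡ Y (punchIn p i) j) →
  ∀ k → detCoeff X k ≡ detCoeff Y k ℤ.+ shift (detCoeff (minor p p X)) k
detCoeff-split p X Y e y k = trans
  (detCoeff-row-+ p X Y Z
    (λ j → trans (e j) (cong (λ r → Y p j ⊕ r j) (sym Z-row)))
    y (λ i j → cong (λ r → r j) (sym (Z-rest i))) k)
  (cong (λ x → detCoeff Y k ℤ.+ x) (trans
    (detCoeff-unit-row p p Z (λ j → cong (λ r → r j) Z-row) k)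
    (trans (cong₂ ℤ._*_ (sign-square p)
        (shift-cong (detCoeff-cong λ i j → cong (λ r → r (punchIn p j)) (Z-rest i)) k))
      (ℤ.*-identityˡ _))))
  where
  Z = insertAt (removeAt X p) p (λ j → 0ℤ , δ p j)
  Z-row = insertAt-lookup (removeAt X p) p (λ j → 0ℤ , δ p j)
  Z-rest = insertAt-punchIn (removeAt X p) p (λ j → 0ℤ , δ p j)

-- The fourth coefficient of the characteristic polynomial.

-- The selector `s` tells which rows carry λ; with all of them the matrix is λI - A. Partial
-- selections arise when rows are split one at a time.
mat : Graph n → (Fin n → Bool) → Mat n
mat G s i j = - adj G i j , (if s i then δ i j else 0ℤ)

all-rows : Fin n → Bool
all-rows _ = true

δ-≢ : {i j : Fin n} → i ≢ j → δ i j ≡ 0ℤ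
δ-≢ {i = zero}  {zero}  i≢j = contradiction refl i≢j
δ-≢ {i = zero}  {suc j} i≢j = refl
δ-≢ {i = suc i} {zero}  i≢j = refl
δ-≢ {i = suc i} {suc j} i≢j = δ-≢ (i≢j ∘ cong suc)

charMatrix-represents : ∀ (G : Graph n) i j → Represents (charMatrix G i j) (mat G all-rows i j)
charMatrix-represents G i j with i ≟ j
... | yes refl rewrite δ-refl i  = represents-linear (- adj G i i) 1ℤ
... | no  i≢j  rewrite δ-≢ i≢j = represents-const (- adj G i j)

delete : Fin (suc n) → Graph (suc n) → Graph n
delete p G i j = G (punchIn p i) (punchIn p j)

minor-mat : ∀ p (G : Graph (suc n)) s i j →
  minor p p (mat G s) i j ≡ mat (delete p G) (s ∘ punchIn p) i j
minor-mat p G s i j rewrite δ-punchIn² p i j = refl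

turnOff : Fin (suc n) → (Fin (suc n) → Bool) → Fin (suc n) → Bool
turnOff p s = insertAt (removeAt s p) p false

turnOff-true : ∀ p (s : Fin (suc n) → Bool) i → turnOff p s i ≡ true → i ≢ p × s i ≡ true
turnOff-true p s i e with p ≟ i
... | yes refl with () ← trans (sym e) (insertAt-lookup (removeAt s p) p false)
... | no  p≢i = p≢i ∘ sym , trans (sym off) e
  where
  off : turnOff p s i ≡ s i
  off = subst (λ x → turnOff p s x ≡ s x) (punchIn-punchOut p≢i)
    (insertAt-punchIn (removeAt s p) p false (punchOut p≢i))

mat-split : ∀ p (G : Graph (suc n)) s → s p ≡ true → ∀ k →
  detCoeff (mat G s) k
    ≡ detCoeff (mat G (turnOff p s)) k ℤ.+ shift (detCoeff (mat (delete p G) (s ∘ punchIn p))) k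
mat-split p G s e k = trans
  (detCoeff-split p (mat G s) (mat G (turnOff p s)) row-p others k)
  (cong (λ x → detCoeff (mat G (turnOff p s)) k ℤ.+ x)
    (shift-cong (detCoeff-cong (minor-mat p G s)) k))
  where
  row-p : ∀ j → mat G s p j ≡ mat G (turnOff p s) p j ⊕ (0ℤ , δ p j)
  row-p j rewrite e | insertAt-lookup (removeAt s p) p false =
    cong₂ _,_ (sym (ℤ.+-identityʳ _)) (sym (ℤ.+-identityˡ _))
  others : ∀ i j → mat G s (punchIn p i) j ≡ mat G (turnOff p s) (punchIn p i) j
  others i j rewrite insertAt-punchIn (removeAt s p) p false i = refl

detCoeff-constant-term : (X Y : Mat n) → (∀ i j → proj₁ (X i j) ≡ proj₁ (Y i j)) →
  detCoeff X 0 ≡ detCoeff Y 0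
detCoeff-constant-term {zero}  X Y e = refl
detCoeff-constant-term {suc n} X Y e = altSum-cong λ j →
  cong₂ ℤ._+_
    (cong₂ ℤ._*_ (e zero j) (detCoeff-constant-term (minor zero j X) (minor zero j Y) λ i l → e (suc i) (punchIn j l)))
    (trans (ℤ.*-zeroʳ (proj₂ (X zero j))) (sym (ℤ.*-zeroʳ (proj₂ (Y zero j)))))

detCoeff-degree-zero : (X : Mat n) → (∀ i j → proj₂ (X i j) ≡ 0ℤ) → ∀ k → detCoeff X (suc k) ≡ 0ℤ
detCoeff-degree-zero {zero}  X e k = refl
detCoeff-degree-zero {suc n} X e k = altSum-zero λ j →
  cong₂ ℤ._+_
    (trans (cong (proj₁ (X zero j) ℤ.*_)
        (detCoeff-degree-zero (minor zero j X) (λ i l → e (suc i) (punchIn j l)) k))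
      (ℤ.*-zeroʳ (proj₁ (X zero j))))
    (cong (ℤ._* detCoeff (minor zero j X) k) (e zero j))

-- Opaque, because otherwise comparing two 4 × 4 determinants expands them.
opaque
  determinant : Graph n → ℤ
  determinant G = detCoeff (mat G all-rows) 0

  determinant-≡ : (G : Graph n) → determinant G ≡ detCoeff (mat G all-rows) 0
  determinant-≡ G = refl

  determinant-cong : {G H : Graph n} → (∀ i j → G i j ≡ H i j) → determinant G ≡ determinant H
  determinant-cong e =
    detCoeff-cong (λ i j → cong (λ b → - (if b then + 1 else + 0) , δ i j) (e i j)) 0

-- A coefficient is a sum of principal minors: either the λ in row p is not
-- used, or row and column p are deleted.
module _ (P : ℤ → Set) (P-0 : P 0ℤ) (P-+ : ∀ {x y} → P x → P y → P (x ℤ.+ y)) where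

  detCoeff-step : ∀ (G : Graph (suc n)) k → (∀ p s → P (detCoeff (mat (delete p G) s) k)) →
    ∀ s → P (detCoeff (mat G s) (suc k))
  detCoeff-step {n} G k deleted s = bounded (suc n) s λ i _ → toℕ<n i
    where
    -- All rows that still carry λ have index below `r`; they are switched off from the last one
    -- down. When none is left the matrix is constant and has no coefficient of positive degree.
    bounded : ∀ r s → (∀ i → s i ≡ true → toℕ i ℕ.< r) → P (detCoeff (mat G s) (suc k))
    lower : ∀ {r s p} → (∀ i → s i ≡ true → toℕ i ℕ.< suc r) → toℕ p ≡ r →
      ∀ i → i ≢ p → s i ≡ true → toℕ i ℕ.< r
    lower b p≡r i i≢p si = ℕ.≤∧≢⇒< (ℕ.≤-pred (b i si))
      (λ i≡r → i≢p (toℕ-injective (trans i≡r (sym p≡r))))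
    bounded zero s b = subst P (sym (detCoeff-degree-zero (mat G s) no-λ k)) P-0
      where
      no-λ : ∀ i j → proj₂ (mat G s i j) ≡ 0ℤ
      no-λ i j with s i in si
      ... | false = refl
      ... | true with () ← b i si
    bounded (suc r) s b with r ℕ.<? suc n
    ... | no r≮N = bounded r s λ i _ → ℕ.<-≤-trans (toℕ<n i) (ℕ.≮⇒≥ r≮N)
    ... | yes r<N with s (fromℕ< r<N) in sp
    ...   | false = bounded r s λ i si →
            lower {s = s} b (toℕ-fromℕ< r<N) i (λ { refl → contradiction (trans (sym si) sp) λ () }) si
    ...   | true = subst P (sym (mat-split p G s sp (suc k)))
            (P-+ (bounded r (turnOff p s) λ i ti →
                   let i≢p , si = turnOff-true p s i ti in lower {s = s} b (toℕ-fromℕ< r<N) i i≢p si)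
                 (deleted p (s ∘ punchIn p)))
      where
      p = fromℕ< r<N

  -- A deletion lowers the order and the degree together, so their difference stays 4 and the
  -- recursion ends at constant terms, where the selector `s` is invisible.
  detCoeff-induction : (C : ∀ {n} → Graph n → Set) →
    (∀ {n} (G : Graph (suc n)) p → C G → C (delete p G)) →
    (∀ {n} (G : Graph n) → n ≡ 4 → C G → P (determinant G)) →
    ∀ {n} k → n ≡ 4 ℕ.+ k → (G : Graph n) → C G → ∀ s → P (detCoeff (mat G s) k)
  detCoeff-induction C C-delete four zero n≡4 G CG s =
    subst P
      (trans (determinant-≡ G) (detCoeff-constant-term (mat G all-rows) (mat G s) λ i j → refl))
      (four G n≡4 CG)
  detCoeff-induction C C-delete four {suc n} (suc k) n≡ G CG s =
    detCoeff-step G k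
      (λ p s → detCoeff-induction C C-delete four k (ℕ.suc-injective n≡) (delete p G) (C-delete G p CG) s) s

-- Determinants of the graphs on four vertices

graph4 : (a b c d e f : Bool) → Graph 4
graph4 a b c d e f i j = lookup (lookup
  ((false ∷ a     ∷ b     ∷ c     ∷ []) ∷
   (a     ∷ false ∷ d     ∷ e     ∷ []) ∷
   (b     ∷ d     ∷ false ∷ f     ∷ []) ∷
   (c     ∷ e     ∷ f     ∷ false ∷ []) ∷ []) i) j

toGraph4 : Graph 4 → Graph 4
toGraph4 G = graph4 (G (# 0) (# 1)) (G (# 0) (# 2)) (G (# 0) (# 3))
  (G (# 1) (# 2)) (G (# 1) (# 3)) (G (# 2) (# 3))

toGraph4-≡ : (G : Graph 4) → IsSimple G → ∀ i j → G i j ≡ toGraph4 G i j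
toGraph4-≡ G (s , r) zero                   zero                   = r _
toGraph4-≡ G (s , r) zero                   (suc zero)             = refl
toGraph4-≡ G (s , r) zero                   (suc (suc zero))       = refl
toGraph4-≡ G (s , r) zero                   (suc (suc (suc zero))) = refl
toGraph4-≡ G (s , r) (suc zero)             zero                   = s _ _
toGraph4-≡ G (s , r) (suc zero)             (suc zero)             = r _
toGraph4-≡ G (s , r) (suc zero)             (suc (suc zero))       = refl
toGraph4-≡ G (s , r) (suc zero)             (suc (suc (suc zero))) = refl
toGraph4-≡ G (s , r) (suc (suc zero))       zero                   = s _ _
toGraph4-≡ G (s , r) (suc (suc zero))       (suc zero)             = s _ _
toGraph4-≡ G (s , r) (suc (suc zero))       (suc (suc zero))       = r _
toGraph4-≡ G (s , r) (suc (suc zero))       (suc (suc (suc zero))) = refl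
toGraph4-≡ G (s , r) (suc (suc (suc zero))) zero                   = s _ _
toGraph4-≡ G (s , r) (suc (suc (suc zero))) (suc zero)             = s _ _
toGraph4-≡ G (s , r) (suc (suc (suc zero))) (suc (suc zero))       = s _ _
toGraph4-≡ G (s , r) (suc (suc (suc zero))) (suc (suc (suc zero))) = r _

∀-Bool? : {P : Bool → Set} → (∀ b → Dec (P b)) → Dec (∀ b → P b)
∀-Bool? P? = map′ (λ { (f , t) false → f ; (f , t) true → t }) (λ h → h false , h true)
  (P? false ×-dec P? true)

InducedPath : Graph n → (w x y z : Fin n) → Set
InducedPath G w x y z =
  G w x ≡ true × G x y ≡ true × G y z ≡ true ×
  G w y ≡ false × G x z ≡ false × G w z ≡ false

inducedPath? : ∀ (G : Graph n) w x y z → Dec (InducedPath G w x y z)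
inducedPath? G w x y z =
  G w x Bool.≟ true ×-dec G x y Bool.≟ true ×-dec G y z Bool.≟ true ×-dec
  G w y Bool.≟ false ×-dec G x z Bool.≟ false ×-dec G w z Bool.≟ false

opaque
  unfolding determinant

  -- Only the complete graph has a negative determinant, and it contains every triangle, so one
  -- fixed triangle serves as the alternative. All 64 graphs are evaluated.
  det4-nonneg-or-triangle : ∀ a b c d e f →
    a ∧ b ∧ d ≡ true ⊎ 0ℤ ℤ.≤ determinant (graph4 a b c d e f)
  det4-nonneg-or-triangle = toWitness
    {a? = ∀-Bool? λ a → ∀-Bool? λ b → ∀-Bool? λ c → ∀-Bool? λ d → ∀-Bool? λ e → ∀-Bool? λ f →
      (a ∧ b ∧ d Bool.≟ true) ⊎-dec (0ℤ ℤ.≤? determinant (graph4 a b c d e f))} _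

opaque
  unfolding determinant

  -- In an induced path `w x y z` the missing edges `w y` and `w z` exclude every perfect matching
  -- but `w x`, `y z`, so the determinant is 1.
  det4-pos-or-pathless : ∀ a b c d e f →
    0ℤ ℤ.< determinant (graph4 a b c d e f)
    ⊎ (∀ w x y z → ¬ InducedPath (graph4 a b c d e f) w x y z)
  det4-pos-or-pathless = toWitness
    {a? = ∀-Bool? λ a → ∀-Bool? λ b → ∀-Bool? λ c → ∀-Bool? λ d → ∀-Bool? λ e → ∀-Bool? λ f →
      (0ℤ ℤ.<? determinant (graph4 a b c d e f))
      ⊎-dec (Fin.all? λ w → Fin.all? λ x → Fin.all? λ y → Fin.all? λ z →
        ¬? (inducedPath? (graph4 a b c d e f) w x y z))} _

-- The complete bipartite graph between the colour classes. A class may be empty, which makes the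
-- family closed under deleting vertices.
xorGraph : (Fin n → Bool) → Graph n
xorGraph c i j = c i xor c j

opaque
  unfolding determinant

  det4-xor-lookup : ∀ a b c d → determinant (xorGraph (lookup (a ∷ b ∷ c ∷ d ∷ []))) ≡ 0ℤ
  det4-xor-lookup = toWitness
    {a? = ∀-Bool? λ a → ∀-Bool? λ b → ∀-Bool? λ c → ∀-Bool? λ d →
      determinant (xorGraph (lookup (a ∷ b ∷ c ∷ d ∷ []))) ℤ.≟ 0ℤ} _

-- Classes closed under vertex deletion, and the sign of their coefficients

delete-simple : ∀ (G : Graph (suc n)) p → IsSimple G → IsSimple (delete p G)
delete-simple G p (s , r) = (λ i j → s _ _) , (λ i → r _)

delete-bipartite : ∀ (G : Graph (suc n)) p → Bipartite G → Bipartite (delete p G)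
delete-bipartite G p (c , proper) = c ∘ punchIn p , λ i j → proper _ _

IsBipartiteSimple : Graph n → Set
IsBipartiteSimple G = IsSimple G × Bipartite G

IsXorGraph : Graph n → Set
IsXorGraph {n} G = ∃ λ (c : Fin n → Bool) → ∀ i j → G i j ≡ xorGraph c i j

delete-bipartiteSimple : ∀ (G : Graph (suc n)) p →
  IsBipartiteSimple G → IsBipartiteSimple (delete p G)
delete-bipartiteSimple G p (s , b) = delete-simple G p s , delete-bipartite G p b

two-colours : ∀ {x y z : Bool} → x ≢ y → y ≢ z → x ≡ z
two-colours {false} {false} {z}     x≢y y≢z = contradiction refl x≢y
two-colours {false} {true}  {false} x≢y y≢z = refl
two-colours {false} {true}  {true}  x≢y y≢z = contradiction refl y≢z
two-colours {true}  {false} {false} x≢y y≢z = contradiction refl y≢z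
two-colours {true}  {false} {true}  x≢y y≢z = refl
two-colours {true}  {true}  {z}     x≢y y≢z = contradiction refl x≢y

triangle-free : (G : Graph n) → Bipartite G → ∀ i j k → G i j ∧ G i k ∧ G j k ≢ true
triangle-free G (c , proper) i j k e with G i j in ij | G i k in ik | G j k in jk
... | true | true | true = proper i k ik (two-colours (proper i j ij) (proper j k jk))

det4-nonneg : (G : Graph n) → n ≡ 4 → IsBipartiteSimple G → 0ℤ ℤ.≤ determinant G
det4-nonneg G refl (simple , bip)
  with det4-nonneg-or-triangle (G (# 0) (# 1)) (G (# 0) (# 2)) (G (# 0) (# 3))
         (G (# 1) (# 2)) (G (# 1) (# 3)) (G (# 2) (# 3))
... | inj₁ triangle = contradiction triangle (triangle-free G bip (# 0) (# 1) (# 2))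
... | inj₂ nonneg   = subst (0ℤ ℤ.≤_) (sym (determinant-cong (toGraph4-≡ G simple))) nonneg

det4-xor : (G : Graph n) → n ≡ 4 → IsXorGraph G → determinant G ≡ 0ℤ
det4-xor G refl (c , e) = trans
  (determinant-cong λ i j → trans (e i j)
    (sym (cong₂ _xor_ (lookup∘tabulate c i) (lookup∘tabulate c j))))
  (det4-xor-lookup (c (# 0)) (c (# 1)) (c (# 2)) (c (# 3)))

detCoeff-nonneg : ∀ k → n ≡ 4 ℕ.+ k → (G : Graph n) → IsBipartiteSimple G →
  ∀ s → 0ℤ ℤ.≤ detCoeff (mat G s) k
detCoeff-nonneg = detCoeff-induction (0ℤ ℤ.≤_) ℤ.≤-refl ℤ.+-mono-≤
  IsBipartiteSimple delete-bipartiteSimple det4-nonneg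

detCoeff-xor : ∀ k → n ≡ 4 ℕ.+ k → (G : Graph n) → IsXorGraph G →
  ∀ s → detCoeff (mat G s) k ≡ 0ℤ
detCoeff-xor = detCoeff-induction (_≡ 0ℤ) refl (cong₂ ℤ._+_)
  IsXorGraph (λ { G p (c , e) → c ∘ punchIn p , λ i j → e _ _ }) det4-xor

-- Positivity from an induced path

-- Otherwise a choice of preimages would inject `Fin n` into the smaller `Fin m`.
avoid : ∀ {m} → m ℕ.< n → (f : Fin m → Fin n) → ∃ λ p → ∀ i → p ≢ f i
avoid m<n f with Fin.any? (λ p → Fin.all? (λ i → ¬? (p ≟ f i)))
... | yes found = found
... | no  none  =
  let i , j , i<j , e = Fin.pigeonhole m<n (proj₁ ∘ preimage)
  in contradiction (trans (proj₂ (preimage i)) (trans (cong f e) (sym (proj₂ (preimage j)))))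
       (Fin.<⇒≢ i<j)
  where
  preimage : ∀ p → ∃ λ i → p ≡ f i
  preimage p with Fin.any? (λ i → p ≟ f i)
  ... | yes found = found
  ... | no  ¬hit  = contradiction (p , λ i e → ¬hit (i , e)) none

-- Consecutive vertices differ because there are no loops; any other two are separated by a vertex
-- of the path adjacent to exactly one of them.
inducedPath-distinct : ∀ (G : Graph n) → IsSimple G → ∀ {w x y z} → InducedPath G w x y z →
  ∀ i j → i Fin.< j → lookup (w ∷ x ∷ y ∷ z ∷ []) i ≢ lookup (w ∷ x ∷ y ∷ z ∷ []) j
inducedPath-distinct G (s , r) (wx , xy , yz , wy , xz , wz) = distinct
  where
  clash : ∀ {b} → b ≡ true → b ≡ false → ⊥
  clash refl ()
  distinct : ∀ i j → i Fin.< j → _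
  distinct zero (suc zero) _ refl = clash wx (r _)
  distinct zero (suc (suc zero)) _ refl = clash yz wz
  distinct zero (suc (suc (suc zero))) _ refl = clash yz (trans (s _ _) wy)
  distinct (suc zero) (suc (suc zero)) _ refl = clash xy (r _)
  distinct (suc zero) (suc (suc (suc zero))) _ refl = clash wx wz
  distinct (suc (suc zero)) (suc (suc (suc zero))) _ refl = clash yz (r _)
  distinct (suc zero) (suc zero) (s≤s ()) _
  distinct (suc (suc zero)) (suc zero) (s≤s ()) _
  distinct (suc (suc zero)) (suc (suc zero)) (s≤s (s≤s ())) _
  distinct (suc (suc (suc zero))) (suc zero) (s≤s ()) _
  distinct (suc (suc (suc zero))) (suc (suc zero)) (s≤s (s≤s ())) _
  distinct (suc (suc (suc zero))) (suc (suc (suc zero))) (s≤s (s≤s (s≤s ()))) _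

inducedPath-size : ∀ (G : Graph n) → IsSimple G → ∀ {w x y z} → InducedPath G w x y z → 4 ≤ n
inducedPath-size G simple {w} {x} {y} {z} path = ℕ.≮⇒≥ λ n<4 →
  let i , j , i<j , e = Fin.pigeonhole n<4 (lookup (w ∷ x ∷ y ∷ z ∷ []))
  in inducedPath-distinct G simple path i j i<j e

det4-pos : (G : Graph n) → n ≡ 4 → IsSimple G → ∀ {w x y z} → InducedPath G w x y z →
  0ℤ ℤ.< determinant G
det4-pos G refl simple {w} {x} {y} {z} (wx , xy , yz , wy , xz , wz)
  with det4-pos-or-pathless (G (# 0) (# 1)) (G (# 0) (# 2)) (G (# 0) (# 3))
         (G (# 1) (# 2)) (G (# 1) (# 3)) (G (# 2) (# 3))
... | inj₁ pos  = subst (0ℤ ℤ.<_) (sym (determinant-cong (toGraph4-≡ G simple))) pos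
... | inj₂ none = contradiction
  (to w x wx , to x y xy , to y z yz , to w y wy , to x z xz , to w z wz) (none w x y z)
  where
  to : ∀ i j {b} → G i j ≡ b → toGraph4 G i j ≡ b
  to i j = trans (sym (toGraph4-≡ G simple i j))

-- Vertices outside the path are deleted one at a time. At each split the deleted summand still
-- contains the path and is positive by induction; the other is nonnegative.
detCoeff-pos : ∀ k → n ≡ 4 ℕ.+ k → (G : Graph n) → IsBipartiteSimple G →
  ∀ {w x y z} → InducedPath G w x y z → 0ℤ ℤ.< detCoeff (mat G all-rows) k
detCoeff-pos zero n≡4 G (simple , _) path = subst (0ℤ ℤ.<_) (determinant-≡ G)
  (det4-pos G n≡4 simple path)
detCoeff-pos {suc n} (suc k) n≡ G bip {w} {x} {y} {z} (wx , xy , yz , wy , xz , wz) =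
  subst (0ℤ ℤ.<_) (sym (mat-split p G all-rows refl (suc k)))
    (ℤ.+-mono-≤-< (detCoeff-nonneg (suc k) n≡ G bip (turnOff p all-rows))
      (detCoeff-pos k (ℕ.suc-injective n≡) (delete p G) (delete-bipartiteSimple G p bip)
        {punchOut (p≢ (# 0))} {punchOut (p≢ (# 1))} {punchOut (p≢ (# 2))} {punchOut (p≢ (# 3))}
        (to wx , to xy , to yz , to wy , to xz , to wz)))
  where
  avoided = avoid (subst (4 ℕ.<_) (sym n≡) (s≤s (ℕ.m≤m+n 4 k))) (lookup (w ∷ x ∷ y ∷ z ∷ []))
  p = proj₁ avoided
  p≢ = proj₂ avoided
  to : ∀ {i j b} {p≢i : p ≢ i} {p≢j : p ≢ j} → G i j ≡ b →
    delete p G (punchOut p≢i) (punchOut p≢j) ≡ b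
  to {p≢i = p≢i} {p≢j} e =
    trans (cong₂ G (punchIn-punchOut p≢i) (punchIn-punchOut p≢j)) e

-- Transfer to `a4`

a4-cases : (G : Graph n) →
  (n ℕ.< 4 × a4 G ≡ 0ℤ) ⊎ (∃ λ k → n ≡ 4 ℕ.+ k × a4 G ≡ detCoeff (mat G all-rows) k)
a4-cases {n} G with 4 ℕ.≤? n
... | no  4≰n = inj₁ (n<4 ,
  cong (λ b → if b then 0ℤ else coeff (charPoly G) (n ∸ 4)) (Equivalence.to T-≡ (ℕ.<⇒<ᵇ n<4)))
  where n<4 = ℕ.≰⇒> 4≰n
... | yes 4≤n = inj₂ (n ∸ 4 , n≡ , trans
  (cong (λ b → if b then 0ℤ else coeff (charPoly G) (n ∸ 4)) (cong (_<ᵇ 4) n≡))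
  (coeff-det (charMatrix G) (mat G all-rows) (charMatrix-represents G) (n ∸ 4)))
  where n≡ = sym (ℕ.m+[n∸m]≡n 4≤n)

a4-nonneg : (G : Graph n) → IsBipartiteSimple G → 0ℤ ℤ.≤ a4 G
a4-nonneg G bip with a4-cases G
... | inj₁ (_ , e)      = ℤ.≤-reflexive (sym e)
... | inj₂ (k , n≡ , e) = subst (0ℤ ℤ.≤_) (sym e) (detCoeff-nonneg k n≡ G bip all-rows)

a4-xor : (G : Graph n) → IsXorGraph G → a4 G ≡ 0ℤ
a4-xor G isXor with a4-cases G
... | inj₁ (_ , e)      = e
... | inj₂ (k , n≡ , e) = trans e (detCoeff-xor k n≡ G isXor all-rows)

a4-pos : (G : Graph n) → IsBipartiteSimple G → ∀ {w x y z} → InducedPath G w x y z → 0ℤ ℤ.< a4 G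
a4-pos G bip path with a4-cases G
... | inj₁ (n<4 , _)    = contradiction (inducedPath-size G (proj₁ bip) path) (ℕ.<⇒≱ n<4)
... | inj₂ (k , n≡ , e) = subst (0ℤ ℤ.<_) (sym e) (detCoeff-pos k n≡ G bip path)

-- Complete bipartite graphs.

count : (Fin n → Bool) → ℕ
count c = sumFin λ i → if c i then 1 else 0

sumFin-cong : {f g : Fin n → ℕ} → (∀ i → f i ≡ g i) → sumFin f ≡ sumFin g
sumFin-cong {zero}  e = refl
sumFin-cong {suc n} e = cong₂ ℕ._+_ (e zero) (sumFin-cong (e ∘ suc))

count+count-not : (c : Fin n → Bool) → count c ℕ.+ count (not ∘ c) ≡ n
count+count-not {zero}  c = refl
count+count-not {suc n} c with c zero
... | true  = cong suc (count+count-not (c ∘ suc))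
... | false = trans (ℕ.+-suc _ _) (cong suc (count+count-not (c ∘ suc)))

numEdges-cong : {G H : Graph n} → (∀ i j → G i j ≡ H i j) → numEdges G ≡ numEdges H
numEdges-cong e = sumFin-cong λ i → sumFin-cong λ j →
  cong (λ b → if toℕ i <ᵇ toℕ j then (if b then 1 else 0) else 0) (e i j)

-- The first vertex is joined to exactly the later vertices of the other colour, so adding it raises
-- one factor of the product by one.
numEdges-xor : (c : Fin n → Bool) → numEdges (xorGraph c) ≡ count c * count (not ∘ c)
numEdges-xor {zero}  c = refl
numEdges-xor {suc n} c with c zero
... | true  = cong (count (not ∘ c ∘ suc) ℕ.+_) (numEdges-xor (c ∘ suc))
... | false = trans (cong (count (c ∘ suc) ℕ.+_) (numEdges-xor (c ∘ suc)))
  (sym (ℕ.*-suc (count (c ∘ suc)) (count (not ∘ c ∘ suc))))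

count-initial : ∀ {t} → t ≤ n → count (λ (i : Fin n) → toℕ i <ᵇ t) ≡ t
count-initial {zero}  z≤n = refl
count-initial {suc n} z≤n = count-initial {n} z≤n
count-initial (s≤s t≤n)   = cong suc (count-initial t≤n)

count-punchIn : ∀ p (c : Fin (suc n) → Bool) →
  count c ≡ (if c p then 1 else 0) ℕ.+ count (c ∘ punchIn p)
count-punchIn zero c = refl
count-punchIn {suc n} (suc p) c rewrite count-punchIn p (c ∘ suc) =
  lem (if c zero then 1 else 0) (if c (suc p) then 1 else 0) (count (c ∘ suc ∘ punchIn p))
  where
  lem : ∀ x y z → x ℕ.+ (y ℕ.+ z) ≡ y ℕ.+ (x ℕ.+ z)
  lem x y z = trans (sym (ℕ.+-assoc x y z)) (trans (cong (ℕ._+ z) (ℕ.+-comm x y)) (ℕ.+-assoc y x z))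

count-false : {c : Fin n → Bool} → (∀ i → c i ≡ false) → count c ≡ 0
count-false {zero}  e = refl
count-false {suc n} e rewrite e zero = count-false (e ∘ suc)

count-not≡ : (c d : Fin n → Bool) → count c ≡ count d → count (not ∘ c) ≡ count (not ∘ d)
count-not≡ c d e = ℕ.+-cancelˡ-≡ (count c) _ _
  (trans (count+count-not c) (trans (sym (count+count-not d)) (cong (ℕ._+ count (not ∘ d)) (sym e))))

find-true : (c : Fin n → Bool) → count c ≢ 0 → ∃ λ p → c p ≡ true
find-true c c≢0 with Fin.any? (λ p → c p Bool.≟ true)
... | yes found = found
... | no  none  = contradiction (count-false λ i → ¬-not λ e → none (i , e)) c≢0

find-colour : (c d : Fin (suc n) → Bool) → count c ≡ count d → ∀ b → c zero ≡ b → ∃ λ p → d p ≡ b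
find-colour c d e true  c0 = find-true d λ d≡0 → ℕ.1+n≢0 (trans
  (cong (λ b → (if b then 1 else 0) ℕ.+ count (c ∘ suc)) (sym c0)) (trans e d≡0))
find-colour c d e false c0 =
  let p , ¬dp = find-true (not ∘ d) λ d≡0 → ℕ.1+n≢0 (trans
        (cong (λ b → (if not b then 1 else 0) ℕ.+ count (not ∘ c ∘ suc)) (sym c0))
        (trans (count-not≡ c d e) d≡0))
  in p , not-injective ¬dp

-- Vertex `zero` is matched with some vertex that has its colour under `d`; deleting both keeps the
-- counts equal.
recolour : (c d : Fin n → Bool) → count c ≡ count d →
  Σ (Permutation′ n) λ π → ∀ i → d (π ⟨$⟩ʳ i) ≡ c i
recolour {zero}  c d e = Permutation.id , λ ()
recolour {suc n} c d e =
  let p , dp≡c0 = find-colour c d e (c zero) refl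
      π , dπ≡c  = recolour (c ∘ suc) (d ∘ punchIn p)
        (ℕ.+-cancelˡ-≡ (if c zero then 1 else 0) _ _
          (trans e (trans (count-punchIn p d)
            (cong (λ b → (if b then 1 else 0) ℕ.+ count (d ∘ punchIn p)) dp≡c0))))
  in insert zero p π , λ { zero → dp≡c0 ; (suc i) → dπ≡c i }

xor-≢ : ∀ {x y} → x ≢ y → x xor y ≡ true
xor-≢ {false} {false} x≢y = contradiction refl x≢y
xor-≢ {false} {true}  x≢y = refl
xor-≢ {true}  {false} x≢y = refl
xor-≢ {true}  {true}  x≢y = contradiction refl x≢y

xor-≡ : ∀ {x y} → x ≡ y → x xor y ≡ false
xor-≡ {x} refl = xor-same x

xorGraph-simple : (c : Fin n → Bool) → IsSimple (xorGraph c)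
xorGraph-simple c = (λ i j → xor-comm (c i) (c j)) , λ i → xor-same (c i)

xorGraph-bipartite : (c : Fin n → Bool) → Bipartite (xorGraph c)
xorGraph-bipartite c = c , λ i j ij ci≡cj → contradiction (trans (sym ij) (xor-≡ ci≡cj)) λ ()

xorGraph-connected : (c : Fin n → Bool) → (∀ b → ∃ λ p → c p ≡ b) → Connected (xorGraph c)
xorGraph-connected c onto i j with c i Bool.≟ c j
... | no  ci≢cj = step (xor-≢ ci≢cj) here
... | yes ci≡cj =
  let w , cw = onto (not (c i))
      ci≢cw  = λ ci≡cw → not-¬ refl (trans ci≡cw cw)
  in step (xor-≢ ci≢cw) (step (xor-≢ λ cw≡cj → ci≢cw (trans ci≡cj (sym cw≡cj))) here)

-- A shortest path of odd length at least three would contain an induced path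
-- on four vertices.
pathless-connected-xor : (G : Graph n) → Connected G → ((c , _) : Bipartite G) →
  (∀ w x y z → ¬ InducedPath G w x y z) → ∀ i j → G i j ≡ xorGraph c i j
pathless-connected-xor G connected (c , proper) pathless i j = by-colour (c i Bool.≟ c j)
  where
  not-adjacent : ∀ {i j} → c i ≡ c j → G i j ≡ false
  not-adjacent ci≡cj = ¬-not λ ij → proper _ _ ij ci≡cj
  adjacent : ∀ {i j} → Reach G i j → c i ≢ c j → G i j ≡ true
  adjacent here ci≢cj = contradiction refl ci≢cj
  adjacent (step ik here) _ = ik
  -- Two steps preserve the colour, so the rest of the walk collapses by recursion to the edge
  -- `l j`. In the walk `i k l j` bipartiteness excludes every chord except `i j`.
  adjacent {i} {j} (step {k = k} ik (step {k = l} kl r)) ci≢cj with G i j in ij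
  ... | true  = refl
  ... | false = contradiction
    (ik , kl , lj , not-adjacent ci≡cl , not-adjacent (two-colours (proper k l kl) cl≢cj) , ij)
    (pathless i k l j)
    where
    ci≡cl = two-colours (proper i k ik) (proper k l kl)
    cl≢cj = λ cl≡cj → ci≢cj (trans ci≡cl cl≡cj)
    lj = adjacent r cl≢cj
  by-colour : Dec (c i ≡ c j) → G i j ≡ xorGraph c i j
  by-colour (yes ci≡cj) = trans (not-adjacent ci≡cj) (sym (xor-≡ ci≡cj))
  by-colour (no  ci≢cj) = trans (adjacent (connected i j) ci≢cj) (sym (xor-≢ ci≢cj))

xor-≅ : (G H : Graph n) (c d : Fin n → Bool) →
  (∀ i j → G i j ≡ xorGraph c i j) → (∀ i j → H i j ≡ xorGraph d i j) →
  count c ≡ count d → G ≅ H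
xor-≅ G H c d G≡ H≡ e =
  let π , dπ≡c = recolour c d e
  in π , λ i j → trans (H≡ _ _) (trans (cong₂ _xor_ (dπ≡c i) (dπ≡c j)) (sym (G≡ i j)))

-- Both {a , b} and {t , u} are the roots of the same quadratic: (a − t)(b − t) = 0.
sum-product : ∀ a b t u → a ℕ.+ b ≡ t ℕ.+ u → a * b ≡ t * u → a ≡ t ⊎ b ≡ t
sum-product a b t u sum prod with ℤ.i*j≡0⇒i≡0∨j≡0 (+ a ℤ.- + t) {+ b ℤ.- + t} vanishes
  where
  sumℤ : + a ℤ.+ + b ≡ + t ℤ.+ + u
  sumℤ = cong +_ sum
  prodℤ : + a ℤ.* + b ≡ + t ℤ.* + u
  prodℤ = trans (sym (ℤ.pos-* a b)) (trans (cong +_ prod) (ℤ.pos-* t u))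
  lem₁ : ∀ a b t → (a ℤ.- t) ℤ.* (b ℤ.- t) ≡ a ℤ.* b ℤ.- t ℤ.* (a ℤ.+ b) ℤ.+ t ℤ.* t
  lem₁ = solve-∀
  lem₂ : ∀ t u → t ℤ.* u ℤ.- t ℤ.* (t ℤ.+ u) ℤ.+ t ℤ.* t ≡ 0ℤ
  lem₂ = solve-∀
  vanishes : (+ a ℤ.- + t) ℤ.* (+ b ℤ.- + t) ≡ 0ℤ
  vanishes = trans (lem₁ (+ a) (+ b) (+ t))
    (trans (cong₂ (λ p s → p ℤ.- + t ℤ.* s ℤ.+ + t ℤ.* + t) prodℤ sumℤ) (lem₂ (+ t) (+ u)))
... | inj₁ a-t≡0 = inj₁ (ℤ.+-injective (ℤ.i-j≡0⇒i≡j _ _ a-t≡0))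
... | inj₂ b-t≡0 = inj₂ (ℤ.+-injective (ℤ.i-j≡0⇒i≡j _ _ b-t≡0))

-- Minimality and uniqueness of `K n t`

initial : ∀ n → ℕ → Fin n → Bool
initial n t i = toℕ i <ᵇ t

count-not-initial : ∀ {t} → t ≤ n → count (not ∘ initial n t) ≡ n ∸ t
count-not-initial {n} {t} t≤n = ℕ.+-cancelˡ-≡ t _ _ (trans
  (cong (ℕ._+ count (not ∘ initial n t)) (sym (count-initial t≤n)))
  (trans (count+count-not (initial n t)) (sym (ℕ.m+[n∸m]≡n t≤n))))

initial-onto : ∀ {t} → 1 ≤ t → t ℕ.< n → ∀ b → ∃ λ p → initial n t p ≡ b
initial-onto {n} {t} 1≤t t<n true  = find-true (initial n t) λ e →
  ℕ.<⇒≢ 1≤t (sym (trans (sym (count-initial (ℕ.<⇒≤ t<n))) e))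
initial-onto {n} {t} 1≤t t<n false =
  let p , e = find-true (not ∘ initial n t) λ e →
        ℕ.<⇒≢ (ℕ.m<n⇒0<n∸m t<n) (sym (trans (sym (count-not-initial (ℕ.<⇒≤ t<n))) e))
  in p , not-injective e

K-InB : ∀ {t} → 1 ≤ t → t ℕ.< n → InB n (t * (n ∸ t)) (K n t)
K-InB {n} {t} 1≤t t<n =
  xorGraph-simple (initial n t) ,
  xorGraph-connected (initial n t) (initial-onto 1≤t t<n) ,
  xorGraph-bipartite (initial n t) ,
  trans (numEdges-xor (initial n t))
    (cong₂ _*_ (count-initial (ℕ.<⇒≤ t<n)) (count-not-initial (ℕ.<⇒≤ t<n)))

xor-≅-K : ∀ {t} → t ≤ n → (G : Graph n) (c : Fin n → Bool) → (∀ i j → G i j ≡ xorGraph c i j) →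
  numEdges G ≡ t * (n ∸ t) → G ≅ K n t
xor-≅-K {n} {t} t≤n G c G≡ edges
  with sum-product (count c) (count (not ∘ c)) t (n ∸ t)
         (trans (count+count-not c) (sym (ℕ.m+[n∸m]≡n t≤n)))
         (trans (sym (trans (numEdges-cong G≡) (numEdges-xor c))) edges)
... | inj₁ a≡t = xor-≅ G (K n t) c (initial n t) G≡ (λ i j → refl)
  (trans a≡t (sym (count-initial t≤n)))
-- Here the class coloured `false` has `t` vertices; swapping the colours leaves the graph
-- unchanged.
... | inj₂ b≡t = xor-≅ G (K n t) (not ∘ c) (initial n t)
  (λ i j → trans (G≡ i j) (sym (xor-annihilates-not (c i) (c j)))) (λ i j → refl)
  (trans b≡t (sym (count-initial t≤n)))

theorem5p1 : (t n m : ℕ) → 1 ≤ t → 1 ≤ n → 1 ≤ m → m ≡ t * (n ∸ t) →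
    BipOptimal n m (K n t) ×
    (∀ (G : Graph n) → BipOptimal n m G → G ≅ K n t)
theorem5p1 t n .(t * (n ∸ t)) 1≤t 1≤n 1≤m refl = (K-InB 1≤t t<n , K-minimal) , unique
  where
  t<n : t ℕ.< n
  -- Truncated subtraction would make the number of edges zero if `n ≤ t`.
  t<n = ℕ.≰⇒> λ n≤t → ℕ.<⇒≢ 1≤m
    (sym (trans (cong (t *_) (ℕ.m≤n⇒m∸n≡0 n≤t)) (ℕ.*-zeroʳ t)))
  a4-K : a4 (K n t) ≡ 0ℤ
  a4-K = a4-xor (K n t) (initial n t , λ i j → refl)
  K-minimal : ∀ H → InB n (t * (n ∸ t)) H → a4 (K n t) ℤ.≤ a4 H
  K-minimal H (simple , _ , bip , _) = subst (ℤ._≤ a4 H) (sym a4-K) (a4-nonneg H (simple , bip))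
  unique : ∀ G → BipOptimal n (t * (n ∸ t)) G → G ≅ K n t
  unique G ((simple , connected , bip , edges) , minimal) =
    xor-≅-K (ℕ.<⇒≤ t<n) G (proj₁ bip) (pathless-connected-xor G connected bip pathless) edges
    where
    pathless : ∀ w x y z → ¬ InducedPath G w x y z
    pathless w x y z path = ℤ.<⇒≱ (a4-pos G (simple , bip) path)
      (subst (a4 G ℤ.≤_) a4-K (minimal (K n t) (K-InB 1≤t t<n)))
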